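{- Let $a,b,c,d,e$ be nonzero integers, and let $f(x)=\frac{(x+a)(x+b)(x+c)}{x}$ and $g(y)=\frac{(y+d)(y+e)(y+cd/a)}{y^2}$. Then the Diophantine equation $z^2=f(x)^2+g(y)^2$ or the Diophantine equation $z^2=f(x)^2-g(y)^2$ has infinitely many nontrivial rational solutions $(x,y,z)\in\mathbb{Q}^3$.
   Context: A solution $(x,y,z)$ of $z^2=f(x)^2\pm g(y)^2$ is called nontrivial if $f(x)g(y)\neq 0$ and $f(x)^2\neq g(y)^2$. -}

module Defs where

open import Data.Integer using (ℤ; 0ℤ; ∣_∣)
open import Data.Rational using (ℚ; mkℚ; ↥_; 0ℚ; _+_; _*_; _-_; _÷_; ≢-nonZero)
open import Data.Nat.Coprimality using (sym; 1-coprimeTo)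
open import Data.Product using (Σ; ∃; _×_; _,_)
open import Data.List using (List)
open import Data.List.Membership.Propositional using (_∉_)
open import Relation.Binary.PropositionalEquality using (_≡_; _≢_; cong)

ι : ℤ → ℚ
ι n = mkℚ n 0 (sym (1-coprimeTo ∣ n ∣))

ι≢0 : {n : ℤ} → n ≢ 0ℤ → ι n ≢ 0ℚ
ι≢0 n≢0 eq = n≢0 (cong ↥_ eq)

f : (a b c : ℤ) (x : ℚ) → x ≢ 0ℚ → ℚ
f a b c x x≢0 = _÷_ ((x + ι a) * (x + ι b) * (x + ι c)) x {{≢-nonZero x≢0}}

cd/a : (a c d : ℤ) → a ≢ 0ℤ → ℚ
cd/a a c d a≢0 = _÷_ (ι c * ι d) (ι a) {{≢-nonZero (ι≢0 a≢0)}}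

g : (a c d e : ℤ) → a ≢ 0ℤ → (y : ℚ) → y ≢ 0ℚ → ℚ
g a c d e a≢0 y y≢0 =
  _÷_ (_÷_ ((y + ι d) * (y + ι e) * (y + cd/a a c d a≢0)) y {{≢-nonZero y≢0}})
      y {{≢-nonZero y≢0}}

data Sign : Set where
  plus minus : Sign

_⊕[_]_ : ℚ → Sign → ℚ → ℚ
u ⊕[ plus ] v = u + v
u ⊕[ minus ] v = u - v

NontrivialSolution : Sign → (a b c d e : ℤ) → a ≢ 0ℤ → ℚ × ℚ × ℚ → Set
NontrivialSolution s a b c d e a≢0 (x , y , z) =
  Σ (x ≢ 0ℚ) λ x≢0 → Σ (y ≢ 0ℚ) λ y≢0 →
    let F = f a b c x x≢0
        G = g a c d e a≢0 y y≢0
    in (z * z ≡ (F * F) ⊕[ s ] (G * G)) × (F * G ≢ 0ℚ) × (F * F ≢ G * G)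

Infinite : (ℚ × ℚ × ℚ → Set) → Set
Infinite P = (L : List (ℚ × ℚ × ℚ)) → ∃ λ t → P t × t ∉ L

{-# OPTIONS --safe #-}
module Submission where

-- The sign + always works.
-- Substituting y = c d / x makes (x + a) (x + c) / x a common factor of f (x) and g (y), and leaves the
-- equation w² = (x + b)² + ((e x + c d) / (a c))², a conic with a rational point unless b e = c d.
-- If b e = c d, put p = d / (a b); substituting y = p c x makes (x + a) (x + b) / x² a common factor and leaves
-- w² = (x (x + c))² + (p (c x + a b))², a curve of genus one. Since b e = c d makes the problem symmetric in
-- a, b, c, and it is homogeneous, we may assume that a, b, c are integers and c is odd. Then some rational
-- point on the curve lies 2-adically close to the origin of the group law, and each doubling brings it
-- strictly closer, so its multiples by powers of 2 are distinct.

open import Defs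
open import Data.Empty using (⊥; ⊥-elim)
open import Data.Integer using (ℤ; 0ℤ; 1ℤ; ∣_∣; _^_)
import Data.Integer as ℤ
import Data.Integer.DivMod as ℤ
import Data.Integer.Properties as ℤ
import Data.Integer.Tactic.RingSolver as ℤ
open import Data.List using (map)
open import Data.List.Membership.Propositional using (_∈_)
open import Data.List.Relation.Unary.Any using (here; there)
open import Data.Nat using (ℕ; zero; suc)
import Data.Nat as ℕ
import Data.Nat.Coprimality as ℕ
import Data.Nat.Divisibility as ℕ
open import Data.Nat.ListAction using (sum)
import Data.Nat.Properties as ℕ
open import Data.Product using (∃; _×_; _,_; proj₁; proj₂)
open import Data.Rational using (ℚ; mkℚ; ↥_; ↧_; 0ℚ; 1ℚ; _÷_; 1/_; ≢-nonZero)
import Data.Rational.Properties as ℚ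
import Data.Rational.Unnormalised as ℚᵘ
import Data.Rational.Unnormalised.Properties as ℚᵘ
open import Data.Sum using (_⊎_; inj₁; inj₂; [_,_]′)
open import Function using (_∘_)
open import Level using (0ℓ)
open import Relation.Binary.PropositionalEquality
open import Relation.Nullary using (yes; no)
open import Relation.Nullary.Decidable using (dec⇒maybe)
open import Tactic.RingSolver.Core.AlmostCommutativeRing using (AlmostCommutativeRing; fromCommutativeRing)

open ≡-Reasoning

module Integers where

  open import Data.Integer using (+_; _+_; _*_; _-_; -_)
  open import Data.Integer.Tactic.RingSolver using (solve-∀)
  open import Algebra.Properties.AbelianGroup ℤ.+-0-abelianGroup using () renaming (∙-cancelʳ to +-cancelʳ)

  -- Parity and divisibility by powers of 2

  Even Odd : ℤ → Set
  Even i = ∃ λ j → i ≡ + 2 * j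
  Odd i = ∃ λ j → i ≡ 1ℤ + + 2 * j

  even-*ˡ : ∀ {i} j → Even i → Even (i * j)
  even-*ˡ j (k , refl) = k * j , ℤ.*-assoc (+ 2) k j

  even-*ʳ : ∀ i {j} → Even j → Even (i * j)
  even-*ʳ i {j} e = subst Even (ℤ.*-comm j i) (even-*ˡ i e)

  even-neg : ∀ {i} → Even i → Even (- i)
  even-neg (k , refl) = - k , ℤ.neg-distribʳ-* (+ 2) k

  odd-neg : ∀ {i} → Odd i → Odd (- i)
  odd-neg (k , refl) = - (k + 1ℤ) , identity k
    where
    identity : ∀ k → - (1ℤ + + 2 * k) ≡ 1ℤ + + 2 * (- (k + 1ℤ))
    identity = solve-∀

  odd-* : ∀ {i j} → Odd i → Odd j → Odd (i * j)
  odd-* (k , refl) (l , refl) = k + l + + 2 * (k * l) , identity k l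
    where
    identity : ∀ k l → (1ℤ + + 2 * k) * (1ℤ + + 2 * l) ≡ 1ℤ + + 2 * (k + l + + 2 * (k * l))
    identity = solve-∀

  odd+even : ∀ {i j} → Odd i → Even j → Odd (i + j)
  odd+even (k , refl) (l , refl) = k + l , identity k l
    where
    identity : ∀ k l → 1ℤ + + 2 * k + + 2 * l ≡ 1ℤ + + 2 * (k + l)
    identity = solve-∀

  even+odd : ∀ {i j} → Even i → Odd j → Odd (i + j)
  even+odd {i} {j} e o = subst Odd (ℤ.+-comm j i) (odd+even o e)

  even⇒¬odd : ∀ {i} → Even i → Odd i → ⊥
  even⇒¬odd (k , refl) (l , eq) = absurd ∣ k - l ∣ (trans (sym (ℤ.abs-* (+ 2) (k - l))) (cong ∣_∣ 2[k-l]≡1))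
    where
    rearrange : ∀ k l → + 2 * (k - l) ≡ + 2 * k - + 2 * l
    rearrange = solve-∀
    cancel : ∀ l → 1ℤ + + 2 * l - + 2 * l ≡ 1ℤ
    cancel = solve-∀
    2[k-l]≡1 : + 2 * (k - l) ≡ 1ℤ
    2[k-l]≡1 = trans (rearrange k l) (trans (cong (_- + 2 * l) eq) (cancel l))
    absurd : ∀ n → 2 ℕ.* n ≢ 1
    absurd (suc n) eq with () ← trans (sym (ℕ.+-suc n (n ℕ.+ 0))) (ℕ.suc-injective eq)

  parity : ∀ i → Even i ⊎ Odd i
  parity i with i ℤ.% + 2 | ℤ.a≡a%n+[a/n]*n i (+ 2) | ℤ.n%d<d i (+ 2)
  ... | 0 | eq | _ = inj₁ (i ℤ./ + 2 , trans eq (trans (ℤ.+-identityˡ _) (ℤ.*-comm (i ℤ./ + 2) (+ 2))))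
  ... | 1 | eq | _ = inj₂ (i ℤ./ + 2 , trans eq (cong (λ j → 1ℤ + j) (ℤ.*-comm (i ℤ./ + 2) (+ 2))))
  ... | suc (suc _) | _ | ℕ.s≤s (ℕ.s≤s ())

  odd≢0 : ∀ {i} → Odd i → i ≢ 0ℤ
  odd≢0 o refl = even⇒¬odd (0ℤ , refl) o

  *-≢0 : ∀ {i j} → i ≢ 0ℤ → j ≢ 0ℤ → i * j ≢ 0ℤ
  *-≢0 {i} i≢0 j≢0 eq = [ i≢0 , j≢0 ]′ (ℤ.i*j≡0⇒i≡0∨j≡0 i eq)

  factorʳ≢0 : ∀ i {j} → i * j ≢ 0ℤ → j ≢ 0ℤ
  factorʳ≢0 i ij≢0 refl = ij≢0 (ℤ.*-zeroʳ i)

  even-factor : ∀ {i j} → Odd i → Even (i * j) → Even j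
  even-factor {i} {j} i-odd ij-even with parity j
  ... | inj₁ j-even = j-even
  ... | inj₂ j-odd = ⊥-elim (even⇒¬odd ij-even (odd-* i-odd j-odd))

  twice : ∀ i → ∣ + 2 * i ∣ ≡ 2 ℕ.* ∣ i ∣
  twice = ℤ.abs-* (+ 2)

  ∣i∣>0 : ∀ {i} → i ≢ 0ℤ → 0 ℕ.< ∣ i ∣
  ∣i∣>0 i≢0 = ℕ.n≢0⇒n>0 (i≢0 ∘ ℤ.∣i∣≡0⇒i≡0)

  ∣i∣<∣2i∣ : ∀ {i} → i ≢ 0ℤ → ∣ i ∣ ℕ.< ∣ + 2 * i ∣
  ∣i∣<∣2i∣ {i} i≢0 = subst (∣ i ∣ ℕ.<_) (sym (twice i)) (ℕ.m<m+n ∣ i ∣ (ℕ.≤-trans (∣i∣>0 i≢0) (ℕ.m≤m+n ∣ i ∣ 0)))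

  -- Since `m` is odd, all of `2^k` divides `i`, and `2^k > k`. This keeps solutions apart: a
  -- coincidence would make a growing power of 2 divide a fixed nonzero integer.
  2^∣odd*i⇒<∣i∣ : ∀ k {m} i t → Odd m → i ≢ 0ℤ → m * i ≡ (+ 2) ^ k * t → k ℕ.< ∣ i ∣
  2^∣odd*i⇒<∣i∣ zero i t m-odd i≢0 eq = ∣i∣>0 i≢0
  2^∣odd*i⇒<∣i∣ (suc k) {m} i t m-odd i≢0 eq
    with even-factor m-odd ((+ 2) ^ k * t , trans eq (ℤ.*-assoc (+ 2) ((+ 2) ^ k) t))
  ... | j , refl = ℕ.≤-trans (ℕ.s≤s k<∣j∣) (∣i∣<∣2i∣ j≢0)
    where
    swap : ∀ m j → + 2 * (m * j) ≡ m * (+ 2 * j)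
    swap = solve-∀
    j≢0 : j ≢ 0ℤ
    j≢0 = factorʳ≢0 (+ 2) i≢0
    k<∣j∣ : k ℕ.< ∣ j ∣
    k<∣j∣ = 2^∣odd*i⇒<∣i∣ k j t m-odd j≢0
      (ℤ.*-cancelˡ-≡ (+ 2) _ _ (trans (swap m j) (trans eq (ℤ.*-assoc (+ 2) ((+ 2) ^ k) t))))

  OddMultiples : (a b c : ℤ) → Set
  OddMultiples a b c = ∃ λ g → ∃ λ a₁ → ∃ λ b₁ → ∃ λ c₁ →
    g ≢ 0ℤ × a ≡ g * a₁ × b ≡ g * b₁ × c ≡ g * c₁ × (Odd a₁ ⊎ Odd b₁ ⊎ Odd c₁)

  -- The three integers are halved together until one of them is odd; `g` collects the powers of 2.
  -- Each halving shrinks the nonzero `a`, so this ends.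
  odd-multiples : ∀ a b c → a ≢ 0ℤ → OddMultiples a b c
  odd-multiples a b c = go ∣ a ∣ a b c ℕ.≤-refl
    where
    unscaled : ∀ a b c → Odd a ⊎ Odd b ⊎ Odd c → OddMultiples a b c
    unscaled a b c o = 1ℤ , a , b , c , (λ ()) , sym (ℤ.*-identityˡ a) , sym (ℤ.*-identityˡ b) , sym (ℤ.*-identityˡ c) , o
    go : ∀ n a b c → ∣ a ∣ ℕ.≤ n → a ≢ 0ℤ → OddMultiples a b c
    go zero a b c ∣a∣≤0 a≢0 = ⊥-elim (a≢0 (ℤ.∣i∣≡0⇒i≡0 (ℕ.n≤0⇒n≡0 ∣a∣≤0)))
    go (suc n) a b c ∣a∣≤1+n a≢0 with parity a | parity b | parity c
    ... | inj₂ o | _ | _ = unscaled a b c (inj₁ o)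
    ... | inj₁ _ | inj₂ o | _ = unscaled a b c (inj₂ (inj₁ o))
    ... | inj₁ _ | inj₁ _ | inj₂ o = unscaled a b c (inj₂ (inj₂ o))
    ... | inj₁ (a′ , refl) | inj₁ (b′ , refl) | inj₁ (c′ , refl)
      with go n a′ b′ c′ (ℕ.≤-pred (ℕ.≤-trans (∣i∣<∣2i∣ (factorʳ≢0 (+ 2) a≢0)) ∣a∣≤1+n)) (factorʳ≢0 (+ 2) a≢0)
    ... | g , a₁ , b₁ , c₁ , g≢0 , refl , refl , refl , o =
      + 2 * g , a₁ , b₁ , c₁ , *-≢0 {+ 2} (λ ()) g≢0 ,
      sym (ℤ.*-assoc (+ 2) g a₁) , sym (ℤ.*-assoc (+ 2) g b₁) , sym (ℤ.*-assoc (+ 2) g c₁) , o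

  -- Doubling on an elliptic curve through its quartic model

  quartic : (A B m n : ℤ) → ℤ
  quartic A B m n = m * m * (m * m) + A * (m * m * (n * n)) + B * (n * n * (n * n))

  -- The exponent k bounds the 2-adic valuation of m / n from above by - k - 1.
  record QuarticPoint (A B : ℤ) (k : ℕ) : Set where
    field
      m n′ e : ℤ
      m-odd : Odd m
      e-odd : Odd e
      n′≢0 : n′ ≢ 0ℤ
    n : ℤ
    n = + 2 * ((+ 2) ^ k * n′)
    field
      on-quartic : e * e ≡ quartic A B m n

  -- (m / n)² is the abscissa of a point of Y² = X (X² + A X + B), and this is the doubling formula there.
  double : ∀ {A B k} → QuarticPoint A B k → QuarticPoint A B (suc k)
  double {A} {B} {k} P = record
    { m = S * S - B * (T * T)
    -- With `X = S / T` and ordinate `m e / n³`, the double has abscissa `(N / (2 m e n))²`; the new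
    -- factor 2 raises the exponent.
    ; n′ = m * e * n′
    ; e = S * S * (S * S) + T * rest
    ; m-odd = odd+even (odd-* S-odd S-odd) (even-neg (even-*ʳ B (even-*ˡ T T-even)))
    ; e-odd = odd+even (odd-* (odd-* S-odd S-odd) (odd-* S-odd S-odd)) (even-*ˡ rest T-even)
    ; n′≢0 = *-≢0 (*-≢0 (odd≢0 m-odd) (odd≢0 e-odd)) n′≢0
    ; on-quartic = begin
        (S * S * (S * S) + T * rest) * (S * S * (S * S) + T * rest)
          ≡⟨ identity A B S T ⟩
        N * N * (N * N) + A * (N * N * (+ 4 * (S * T * quartic A B m n))) + B * (+ 4 * (S * T * quartic A B m n) * (+ 4 * (S * T * quartic A B m n)))
          ≡⟨ cong (λ ε → N * N * (N * N) + A * (N * N * ε) + B * (ε * ε)) n² ⟩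
        quartic A B N (+ 2 * ((+ 2) ^ suc k * (m * e * n′))) ∎
    }
    where
    open QuarticPoint P
    S T N rest : ℤ
    S = m * m
    T = n * n
    N = S * S - B * (T * T)
    rest = + 2 * A * (S * S * S) + + 6 * B * (S * S * T) + + 2 * A * B * (S * (T * T)) + B * B * (T * T * T)
    S-odd : Odd S
    S-odd = odd-* m-odd m-odd
    T-even : Even T
    T-even = even-*ˡ n ((+ 2) ^ k * n′ , refl)
    -- `ε` is the square of the new `n` with `e²` replaced by the quartic, which makes the equation
    -- an identity of polynomials.
    identity : ∀ A B S T →
      let N = S * S - B * (T * T)
          rest = + 2 * A * (S * S * S) + + 6 * B * (S * S * T) + + 2 * A * B * (S * (T * T)) + B * B * (T * T * T)
          ε = + 4 * (S * T * (S * S + A * (S * T) + B * (T * T)))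
      in (S * S * (S * S) + T * rest) * (S * S * (S * S) + T * rest) ≡ N * N * (N * N) + A * (N * N * ε) + B * (ε * ε)
    identity = solve-∀
    rearrange : ∀ m e w v → let n = + 2 * (w * v) in
      + 4 * (m * m * (n * n) * (e * e)) ≡ + 2 * (+ 2 * w * (m * e * v)) * (+ 2 * (+ 2 * w * (m * e * v)))
    rearrange = solve-∀
    n² : + 4 * (S * T * quartic A B m n) ≡ + 2 * (+ 2 * (+ 2) ^ k * (m * e * n′)) * (+ 2 * (+ 2 * (+ 2) ^ k * (m * e * n′)))
    n² = trans (cong (λ ε → + 4 * (S * T * ε)) (sym on-quartic)) (rearrange m e ((+ 2) ^ k) n′)

  -- Substituting `w = x (x + c) - X / (2 q²)` into `w² = (x (x + c))² + (r (c x + t) / q)²` leaves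
  -- a quadratic in `x`; `q⁶` times its discriminant is `X (X² + A X + B)`.
  A-coeff B-coeff : (q r c t : ℤ) → ℤ
  A-coeff q r c t = c * c * (q * q + r * r)
  B-coeff q r c t = - (+ 4 * (q * q * (r * r) * (t * (t - c * c))))

  -- Twice the point with abscissa - (c r)² on Y² = X (X² + A X + B).
  base-point : ∀ q r c t → q ≢ 0ℤ → Odd r → Odd c → QuarticPoint (A-coeff q r c t) (B-coeff q r c t) 0
  base-point q r c t q≢0 r-odd c-odd = record
    { m = C * C * R + + 2 * (+ 2 * (Q * κ))
    ; n′ = c * q * h
    ; e = - (C * C * (C * C) * (R * R)) + + 2 * half
    ; m-odd = odd+even (odd-* (odd-* C-odd C-odd) R-odd) (_ , refl)
    ; e-odd = odd+even (odd-neg (odd-* (odd-* (odd-* C-odd C-odd) (odd-* C-odd C-odd)) (odd-* R-odd R-odd))) (half , refl)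
    ; n′≢0 = *-≢0 (*-≢0 (odd≢0 c-odd) q≢0) (odd≢0 h-odd)
    ; on-quartic = trans (identity C Q R κ)
        (cong (λ ε → N * N * (N * N) + C * (Q + R) * (N * N * ε) + - (+ 4 * (Q * R * κ)) * (ε * ε)) (n² q c t))
    }
    where
    C Q R κ h N half : ℤ
    C = c * c
    Q = q * q
    R = r * r
    κ = t * (t - c * c)
    -- At `X = - (c r)²` the factor `X² + A X + B` equals `- (q r h)²`, so the ordinate is
    -- `c q r² h` up to sign.
    h = + 2 * t + - C
    N = C * C * R + + 2 * (+ 2 * (Q * κ))
    half = - (C * C * (C * C) * (R * Q)) - + 8 * (Q * R * (C * C) * κ) + + 4 * (C * C * (Q * Q) * κ) + + 8 * (Q * Q * (κ * κ))
    C-odd : Odd C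
    C-odd = odd-* c-odd c-odd
    R-odd : Odd R
    R-odd = odd-* r-odd r-odd
    h-odd : Odd h
    h-odd = even+odd (t , refl) (odd-neg C-odd)
    identity : ∀ C Q R κ →
      let N = C * C * R + + 2 * (+ 2 * (Q * κ))
          ε = + 4 * (C * Q * (+ 4 * κ + C * C))
          e = - (C * C * (C * C) * (R * R)) + + 2 * (- (C * C * (C * C) * (R * Q)) - + 8 * (Q * R * (C * C) * κ)
                + + 4 * (C * C * (Q * Q) * κ) + + 8 * (Q * Q * (κ * κ)))
      in e * e ≡ N * N * (N * N) + C * (Q + R) * (N * N * ε) + - (+ 4 * (Q * R * κ)) * (ε * ε)
    identity = solve-∀
    n² : ∀ q c t → + 4 * (c * c * (q * q) * (+ 4 * (t * (t - c * c)) + c * c * (c * c))) ≡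
      + 2 * (1ℤ * (c * q * (+ 2 * t + - (c * c)))) * (+ 2 * (1ℤ * (c * q * (+ 2 * t + - (c * c)))))
    n² = solve-∀

  quartic-point : ∀ q r c t → q ≢ 0ℤ → r ≢ 0ℤ → Odd q ⊎ Odd r → Odd c →
    ∀ k → QuarticPoint (A-coeff q r c t) (B-coeff q r c t) k
  quartic-point q r c t q≢0 r≢0 q|r-odd c-odd (suc k) = double (quartic-point q r c t q≢0 r≢0 q|r-odd c-odd k)
  quartic-point q r c t q≢0 r≢0 (inj₂ r-odd) c-odd zero = base-point q r c t q≢0 r-odd c-odd
  -- The base point asks for an odd `r`; both coefficients are symmetric in `q` and `r`, so the two
  -- may be exchanged.
  quartic-point q r c t q≢0 r≢0 (inj₁ q-odd) c-odd zero =
    subst₂ (λ A B → QuarticPoint A B 0) (A-sym q r c) (B-sym q r c t) (base-point r q c t r≢0 q-odd c-odd)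
    where
    A-sym : ∀ q r c → c * c * (r * r + q * q) ≡ c * c * (q * q + r * r)
    A-sym = solve-∀
    B-sym : ∀ q r c t → - (+ 4 * (r * r * (q * q) * (t * (t - c * c)))) ≡ - (+ 4 * (q * q * (r * r) * (t * (t - c * c))))
    B-sym = solve-∀

  -- Pythagorean triples from points on the quartic

  2^k≢0 : ∀ k → (+ 2) ^ k ≢ 0ℤ
  2^k≢0 (suc k) = *-≢0 {+ 2} (λ ()) (2^k≢0 k)

  -- The inequalities express nontriviality; over the integers they can be settled by parity.
  record PythagoreanTriple : Set where
    field
      U V W : ℤ
      U≢0 : U ≢ 0ℤ
      V≢0 : V ≢ 0ℤ
      U²≢V² : U * U ≢ V * V
      pythagoras : W * W ≡ U * U + V * V

  odd²≢even² : ∀ {i j} → Odd i → Even j → i * i ≢ j * j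
  odd²≢even² {j = j} i-odd j-even eq = even⇒¬odd (even-*ˡ j j-even) (subst Odd eq (odd-* i-odd i-odd))

  -- With x = - N / M, the Pythagorean triple is M² (x (x + c), r (c x + t) / q, w).
  record EllipticTriple (q r c t : ℤ) (k : ℕ) : Set where
    field
      N s : ℤ
    M : ℤ
    M = + 2 * ((+ 2) ^ k * s)
    field
      N-odd : Odd N
      M≢0 : M ≢ 0ℤ
      triple : PythagoreanTriple
    open PythagoreanTriple triple public
    field
      U-eq : U ≡ N * (N - c * M)
      V-eq : q * V ≡ r * (M * (t * M - c * N))

  -- Setting w = x (x + c) - (m / n)² / (2 q²) turns w² = (x (x + c))² + (r (c x + t) / q)² into a quadratic
  -- equation in x; its discriminant is a square because (m, n, e) lies on the quartic.
  elliptic-triple : ∀ q r c t → q ≢ 0ℤ → r ≢ 0ℤ → Odd q ⊎ Odd r → Odd c → ∀ k → EllipticTriple q r c t k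
  elliptic-triple q r c t q≢0 r≢0 q|r-odd c-odd k = record
    { N = N
    ; s = s
    ; N-odd = N-odd
    ; M≢0 = M≢0
    ; triple = record
      { U = N * (N - c * M)
      ; V = V
      ; W = N * (N - c * M) - + 2 * (m * m * (M₁ * M₁))
      ; U≢0 = odd≢0 U-odd
      ; V≢0 = *-≢0 {+ 2} (λ ()) (*-≢0 (*-≢0 (*-≢0 r≢0 n≢0) (odd≢0 M₁-odd)) (odd≢0 (even+odd (even-*ʳ t M-even) (odd-neg (odd-* c-odd N-odd)))))
      ; U²≢V² = odd²≢even² U-odd (r * n * M₁ * (t * M + - (c * N)) , refl)
      ; pythagoras = pythagoras
      }
    ; U-eq = refl
    ; V-eq = trans (V-identity q r n M₁ (t * M - c * N)) (cong (λ i → r * (i * (t * M - c * N))) (M-identity q M₁ ((+ 2) ^ k) n′))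
    }
    where
    open QuarticPoint (quartic-point q r c t q≢0 r≢0 q|r-odd c-odd k)
    M₁ N s M V Z : ℤ
    -- Multiplied by `q² n²`, the quadratic in `x` has leading coefficient `M₁`, linear coefficient
    -- `Z / q`, and `m e / (q n)` as a square root of its discriminant. The quadratic formula gives
    -- the root `- N / M`.
    M₁ = m * m + r * r * (c * c) * (n * n)
    Z = q * c * (m * m) + + 2 * (q * (r * r) * c * t * (n * n))
    N = m * e + n * Z
    s = + 2 * (q * n′ * M₁)
    M = + 2 * ((+ 2) ^ k * s)
    V = + 2 * (r * n * M₁ * (t * M + - (c * N)))
    n-even : Even n
    n-even = (+ 2) ^ k * n′ , refl
    M-even : Even M
    M-even = (+ 2) ^ k * s , refl
    M₁-odd : Odd M₁
    M₁-odd = odd+even (odd-* m-odd m-odd) (even-*ʳ (r * r * (c * c)) (even-*ˡ n n-even))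
    N-odd : Odd N
    N-odd = odd+even (odd-* m-odd e-odd) (even-*ˡ Z n-even)
    U-odd : Odd (N * (N - c * M))
    U-odd = odd-* N-odd (odd+even N-odd (even-neg (even-*ʳ c M-even)))
    n≢0 : n ≢ 0ℤ
    n≢0 = *-≢0 {+ 2} (λ ()) (*-≢0 (2^k≢0 k) n′≢0)
    M≢0 : M ≢ 0ℤ
    M≢0 = *-≢0 {+ 2} (λ ()) (*-≢0 (2^k≢0 k) (*-≢0 {+ 2} (λ ()) (*-≢0 (*-≢0 q≢0 n′≢0) (odd≢0 M₁-odd))))
    V-identity : ∀ q r n M₁ L → q * (+ 2 * (r * n * M₁ * L)) ≡ r * (+ 2 * (q * n * M₁) * L)
    V-identity = solve-∀
    M-identity : ∀ q M₁ w v → + 2 * (q * (+ 2 * (w * v)) * M₁) ≡ + 2 * (w * (+ 2 * (q * v * M₁)))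
    M-identity = solve-∀
    identity : ∀ q r c t m n e →
      let M₁ = m * m + r * r * (c * c) * (n * n)
          N = m * e + n * (q * c * (m * m) + + 2 * (q * (r * r) * c * t * (n * n)))
          M = + 2 * (q * n * M₁)
          L = t * M - c * N
      in m * m * (m * m) * (M₁ * M₁) + m * m * M₁ * (e * e)
         ≡ m * m * (N * (N - c * M)) + r * r * (n * n) * (L * L)
           + m * m * M₁ * (m * m * (m * m) + c * c * (q * q + r * r) * (m * m * (n * n))
             + - (+ 4 * (q * q * (r * r) * (t * (t - c * c)))) * (n * n * (n * n)))
    identity = solve-∀
    -- The quadratic at `x = - N / M`, cleared of denominators. `identity` holds for all integers
    -- because it carries a multiple of `e²` on the left and the same multiple of the quartic on the
    -- right; `on-quartic` lets these cancel.
    key : m * m * (m * m) * (M₁ * M₁) ≡ m * m * (N * (N - c * M)) + r * r * (n * n) * ((t * M - c * N) * (t * M - c * N))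
    key = +-cancelʳ (m * m * M₁ * (e * e)) _ _
      (trans (subst (λ M → m * m * (m * m) * (M₁ * M₁) + m * m * M₁ * (e * e) ≡ m * m * (N * (N - c * M)) + r * r * (n * n) * ((t * M - c * N) * (t * M - c * N)) + m * m * M₁ * quartic (A-coeff q r c t) (B-coeff q r c t) m n)
          (M-identity q M₁ ((+ 2) ^ k) n′) (identity q r c t m n e))
        (cong (λ ε → m * m * (N * (N - c * M)) + r * r * (n * n) * ((t * M - c * N) * (t * M - c * N)) + m * m * M₁ * ε) (sym on-quartic)))
    W-identity₁ : ∀ U S M₁ → (U - + 2 * (S * (M₁ * M₁))) * (U - + 2 * (S * (M₁ * M₁))) ≡ U * U + + 4 * (M₁ * M₁) * (S * S * (M₁ * M₁) - S * U)
    W-identity₁ = solve-∀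
    W-identity₂ : ∀ U S r n M₁ L → U * U + + 4 * (M₁ * M₁) * (S * U + r * r * (n * n) * (L * L) - S * U) ≡ U * U + + 2 * (r * n * M₁ * L) * (+ 2 * (r * n * M₁ * L))
    W-identity₂ = solve-∀
    pythagoras : (N * (N - c * M) - + 2 * (m * m * (M₁ * M₁))) * (N * (N - c * M) - + 2 * (m * m * (M₁ * M₁))) ≡ N * (N - c * M) * (N * (N - c * M)) + V * V
    pythagoras = trans (W-identity₁ (N * (N - c * M)) (m * m) M₁)
      (trans (cong (λ i → N * (N - c * M) * (N * (N - c * M)) + + 4 * (M₁ * M₁) * (i - m * m * (N * (N - c * M)))) key)
        (W-identity₂ (N * (N - c * M)) (m * m) r n M₁ (t * M - c * N)))

open Integers
open import Data.Rational using (_+_; _*_; _-_; -_)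
open import Tactic.RingSolver using (solve-∀)

-- Integers and fractions inside the rationals

ℚ-ring : AlmostCommutativeRing 0ℓ 0ℓ
ℚ-ring = fromCommutativeRing ℚ.+-*-commutativeRing λ q → dec⇒maybe (0ℚ ℚ.≟ q)

ι-injective : ∀ {i j} → ι i ≡ ι j → i ≡ j
ι-injective = cong ↥_

ι-* : ∀ i j → ι (i ℤ.* j) ≡ ι i * ι j
ι-* i j = ℚ.toℚᵘ-injective (ℚᵘ.≃-sym (ℚ.toℚᵘ-homo-* (ι i) (ι j)))

ι-+ : ∀ i j → ι (i ℤ.+ j) ≡ ι i + ι j
ι-+ i j = ℚ.toℚᵘ-injective (ℚᵘ.≃-sym (ℚᵘ.≃-trans (ℚ.toℚᵘ-homo-+ (ι i) (ι j))
  (ℚᵘ.≃-reflexive (cong₂ (λ i j → ℚᵘ.mkℚᵘ (i ℤ.+ j) 0) (ℤ.*-identityʳ i) (ℤ.*-identityʳ j)))))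

ι-neg : ∀ i → ι (ℤ.- i) ≡ - ι i
ι-neg i = ℚ.toℚᵘ-injective (ℚᵘ.≃-sym (ℚ.toℚᵘ-homo‿- (ι i)))

ι-sub : ∀ i j → ι (i ℤ.- j) ≡ ι i - ι j
ι-sub i j = trans (ι-+ i (ℤ.- j)) (cong (λ q → ι i + q) (ι-neg j))

num/den : ∀ x → x * ι (↧ x) ≡ ι (↥ x)
num/den x@(mkℚ n d _) = ℚ.toℚᵘ-injective (ℚᵘ.≃-trans (ℚ.toℚᵘ-homo-* x (ι (↧ x)))
  (ℚᵘ.*≡* (trans (ℤ.*-identityʳ _) (cong (λ k → n ℤ.* ℤ.+ suc k) (sym (ℕ.*-identityʳ d))))))

inverse : ∀ {x} → x ≢ 0ℚ → ∃ λ i → i * x ≡ 1ℚ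
inverse {x} x≢0 = 1/ x , ℚ.*-inverseˡ x
  where instance _ = ≢-nonZero x≢0

*-cancelˡ : ∀ {x y z} → x ≢ 0ℚ → x * y ≡ x * z → y ≡ z
*-cancelˡ {x} {y} {z} x≢0 eq with inverse x≢0
... | i , ix≡1 = begin
  y            ≡⟨ ℚ.*-identityˡ y ⟨
  1ℚ * y       ≡⟨ cong (_* y) ix≡1 ⟨
  i * x * y    ≡⟨ ℚ.*-assoc i x y ⟩
  i * (x * y)  ≡⟨ cong (i *_) eq ⟩
  i * (x * z)  ≡⟨ ℚ.*-assoc i x z ⟨
  i * x * z    ≡⟨ cong (_* z) ix≡1 ⟩
  1ℚ * z       ≡⟨ ℚ.*-identityˡ z ⟩
  z            ∎

_*≢0_ : ∀ {x y} → x ≢ 0ℚ → y ≢ 0ℚ → x * y ≢ 0ℚ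
_*≢0_ {x} x≢0 y≢0 eq = y≢0 (*-cancelˡ x≢0 (trans eq (sym (ℚ.*-zeroʳ x))))

inverse≢0 : ∀ {i x} → i * x ≡ 1ℚ → i ≢ 0ℚ
inverse≢0 {x = x} ix≡1 refl with () ← trans (sym (ℚ.*-zeroˡ x)) ix≡1

x+i≢0 : ∀ {x} i → x ≢ ι (ℤ.- i) → x + ι i ≢ 0ℚ
x+i≢0 {x} i x≢-i eq = x≢-i (begin
  x                ≡⟨ rearrange x (ι i) ⟩
  x + ι i - ι i    ≡⟨ cong (_- ι i) eq ⟩
  0ℚ - ι i         ≡⟨ ℚ.+-identityˡ (- ι i) ⟩
  - ι i            ≡⟨ ι-neg i ⟨
  ι (ℤ.- i)      ∎)
  where
  rearrange : ∀ x j → x ≡ x + j - j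
  rearrange = solve-∀ ℚ-ring

÷-unique : ∀ {w x y} (y≢0 : y ≢ 0ℚ) → w * y ≡ x → _÷_ x y {{≢-nonZero y≢0}} ≡ w
÷-unique {w} {y = y} y≢0 refl = trans (ℚ.*-assoc w y (1/ y)) (trans (cong (w *_) (ℚ.*-inverseʳ y)) (ℚ.*-identityʳ w))
  where instance _ = ≢-nonZero y≢0

÷-* : ∀ x {y} (y≢0 : y ≢ 0ℚ) → _÷_ x y {{≢-nonZero y≢0}} * y ≡ x
÷-* x {y} y≢0 = trans (ℚ.*-assoc x (1/ y) y) (trans (cong (x *_) (ℚ.*-inverseˡ y)) (ℚ.*-identityʳ x))
  where instance _ = ≢-nonZero y≢0

-- Moves a coincidence of abscissas to the integers, where divisibility by powers of 2 can refute
-- it.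
cross-multiply : ∀ {x} i j → x * ι j ≡ ι i → ∀ x₀ → x ≡ x₀ → ↥ x₀ ℤ.* j ≡ i ℤ.* ↧ x₀
cross-multiply {x} i j eq x₀ refl = ι-injective (begin
  ι (↥ x ℤ.* j)         ≡⟨ ι-* (↥ x) j ⟩
  ι (↥ x) * ι j           ≡⟨ cong (_* ι j) (num/den x) ⟨
  x * ι (↧ x) * ι j       ≡⟨ rearrange x (ι (↧ x)) (ι j) ⟩
  x * ι j * ι (↧ x)       ≡⟨ cong (_* ι (↧ x)) eq ⟩
  ι i * ι (↧ x)           ≡⟨ ι-* i (↧ x) ⟨
  ι (i ℤ.* ↧ x)         ∎)
  where
  rearrange : ∀ x d j → x * d * j ≡ x * j * d
  rearrange = solve-∀ ℚ-ring

-- Families of solutions and their infinitude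

-- A triple (x, y, z) with f(x) = v U, g(y) = v V and z = v W; the zeros of g are - α, - β, - γ.
record Solution (a b c α β γ : ℚ) : Set where
  field
    x y v : ℚ
    triple : PythagoreanTriple
  open PythagoreanTriple triple public
  field
    x≢0 : x ≢ 0ℚ
    y≢0 : y ≢ 0ℚ
    v≢0 : v ≢ 0ℚ
    f-eq : v * ι U * x ≡ (x + a) * (x + b) * (x + c)
    g-eq : v * ι V * (y * y) ≡ (y + α) * (y + β) * (y + γ)

-- The solutions need not be shown pairwise distinct: as every abscissa dies out from some index on,
-- an index beyond the bounds of all members of a finite list gives a solution outside it.
record Family (a b c α β γ : ℚ) : Set where
  field
    bound : ℚ → ℕ
    solution : ℕ → Solution a b c α β γ
    avoids : ∀ k x₀ → bound x₀ ℕ.≤ k → Solution.x (solution k) ≢ x₀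

map-family : ∀ {a b c α β γ a′ b′ c′ α′ β′ γ′} →
  (∀ x → (x + a) * (x + b) * (x + c) ≡ (x + a′) * (x + b′) * (x + c′)) →
  (∀ y → (y + α) * (y + β) * (y + γ) ≡ (y + α′) * (y + β′) * (y + γ′)) →
  Family a b c α β γ → Family a′ b′ c′ α′ β′ γ′
map-family f≡f′ g≡g′ S = record
  { bound = bound
  ; solution = λ k → let open Solution (solution k) in record
    { x = x ; y = y ; v = v ; triple = triple ; x≢0 = x≢0 ; y≢0 = y≢0 ; v≢0 = v≢0
    ; f-eq = trans f-eq (f≡f′ x)
    ; g-eq = trans g-eq (g≡g′ y)
    }
  ; avoids = avoids
  }
  where open Family S

-- The sum serves as a common upper bound in place of a maximum.
bounded-by-sum : ∀ {A : Set} (h : A → ℕ) {t L} → t ∈ L → h t ℕ.≤ sum (map h L)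
bounded-by-sum h (here refl) = ℕ.m≤m+n _ _
bounded-by-sum h (there t∈L) = ℕ.≤-trans (bounded-by-sum h t∈L) (ℕ.m≤n+m _ _)

-- The equation and both inequalities are homogeneous of degree 2, so the nonzero factor `v` carries
-- them over from the integer triple.
nontrivial-solution : ∀ {a b c d e} {a≢0 : a ≢ 0ℤ} (S : Solution (ι a) (ι b) (ι c) (ι d) (ι e) (cd/a a c d a≢0)) →
  let open Solution S in NontrivialSolution plus a b c d e a≢0 (x , y , v * ι W)
nontrivial-solution {a} {b} {c} {d} {e} {a≢0} S =
  x≢0 , y≢0 ,
  trans (square v W W) (trans (cong (λ i → v * v * ι i) pythagoras)
    (trans (cong (v * v *_) (ι-+ (U ℤ.* U) (V ℤ.* V))) (trans (ℚ.*-distribˡ-+ (v * v) _ _)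
      (cong₂ _+_ (trans (sym (square v U U)) (cong₂ _*_ vU vU)) (trans (sym (square v V V)) (cong₂ _*_ vV vV)))))) ,
  subst₂ (λ F G → F * G ≢ 0ℚ) vU vV ((v≢0 *≢0 ι≢0 U≢0) *≢0 (v≢0 *≢0 ι≢0 V≢0)) ,
  subst₂ (λ F G → F * F ≢ G * G) vU vV (λ eq → U²≢V² (ι-injective (*-cancelˡ (v≢0 *≢0 v≢0)
    (trans (sym (square v U U)) (trans eq (square v V V))))))
  where
  open Solution S
  vU : v * ι U ≡ f a b c x x≢0
  vU = sym (÷-unique x≢0 f-eq)
  vV : v * ι V ≡ g a c d e a≢0 y y≢0
  vV = sym (÷-unique y≢0 (sym (÷-unique y≢0 (trans (ℚ.*-assoc (v * ι V) y y) g-eq))))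
  square : ∀ v i j → v * ι i * (v * ι j) ≡ v * v * ι (i ℤ.* j)
  square v i j = trans (rearrange v (ι i) (ι j)) (cong (v * v *_) (sym (ι-* i j)))
    where
    rearrange : ∀ v m n → v * m * (v * n) ≡ v * v * (m * n)
    rearrange = solve-∀ ℚ-ring

reverse : ∀ α β γ y → (y + α) * (y + β) * (y + γ) ≡ (y + γ) * (y + β) * (y + α)
reverse = solve-∀ ℚ-ring

infinite : ∀ {a b c d e} {a≢0 : a ≢ 0ℤ} → Family (ι a) (ι b) (ι c) (ι d) (ι e) (cd/a a c d a≢0) →
  Infinite (NontrivialSolution plus a b c d e a≢0)
infinite {a} {b} {c} {d} {e} {a≢0} S L =
  (x , y , v * ι W) , nontrivial-solution {a} {b} {c} {d} {e} {a≢0} (solution k) ,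
  λ t∈L → avoids k _ (bounded-by-sum (bound ∘ proj₁) t∈L) refl
  where
  open Family S
  k = sum (map (bound ∘ proj₁) L)
  open Solution (solution k)


-- The case `b e ≢ c d`: points on a conic

module Conic (a b c d e : ℤ) (α : ℚ) (a≢0 : a ≢ 0ℤ) (c≢0 : c ≢ 0ℤ) (d≢0 : d ≢ 0ℤ)
  (aα≡cd : ι a * α ≡ ι c * ι d) (be≢cd : b ℤ.* e ≢ c ℤ.* d) where

  δ : ℤ
  δ = b ℤ.* e ℤ.- c ℤ.* d

  δ≢0 : δ ≢ 0ℤ
  δ≢0 = be≢cd ∘ ℤ.i-j≡0⇒i≡j _ _

  -- If `x = x₀`, then `a c N (x + b) = M (e x + c d)` makes `M`, a power of 2, divide `N` times
  -- this integer, and `N` is odd.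
  bound : ℚ → ℕ
  bound x₀ = ∣ a ℤ.* c ℤ.* (↥ x₀ ℤ.+ b ℤ.* ↧ x₀) ∣

  -- Indices start late enough for `x` to avoid `0`, `- a` and `- c`; the summand `∣ a c ∣` keeps
  -- the denominator `X₁` of `x` nonzero.
  K : ℕ → ℕ
  K k = k ℕ.+ (∣ a ℤ.* c ∣ ℕ.+ (bound 0ℚ ℕ.+ (bound (ι (ℤ.- a)) ℕ.+ bound (ι (ℤ.- c)))))

  module _ (k : ℕ) where

    -- On the conic, x + b : (e x + c d) / (a c) : w = 2 j : j² - 1 : j² + 1.
    j M N X₀ X₁ : ℤ
    j = ℤ.+ 2 ℤ.* (ℤ.+ 2) ^ K k
    M = ℤ.+ 2 ℤ.* j
    N = ℤ.- 1ℤ ℤ.+ j ℤ.* j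
    -- Solving `a c N (x + b) = M (e x + c d)` for `x` gives `X₀ / X₁`.
    X₀ = N ℤ.* (a ℤ.* b ℤ.* c) ℤ.- c ℤ.* d ℤ.* M
    X₁ = e ℤ.* M ℤ.- a ℤ.* c ℤ.* N

    j-even : Even j
    j-even = (ℤ.+ 2) ^ K k , refl

    N-odd : Odd N
    N-odd = odd+even (odd-neg (0ℤ , refl)) (even-*ˡ j j-even)

    M≢0 : M ≢ 0ℤ
    M≢0 = *-≢0 {ℤ.+ 2} (λ ()) (*-≢0 {ℤ.+ 2} (λ ()) (2^k≢0 (K k)))

    triple : PythagoreanTriple
    triple = record
      { U = M
      ; V = N
      ; W = 1ℤ ℤ.+ j ℤ.* j
      ; U≢0 = M≢0
      ; V≢0 = odd≢0 N-odd
      ; U²≢V² = odd²≢even² N-odd (j , refl) ∘ sym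
      ; pythagoras = identity j
      }
      where
      identity : ∀ j → (1ℤ ℤ.+ j ℤ.* j) ℤ.* (1ℤ ℤ.+ j ℤ.* j) ≡
        ℤ.+ 2 ℤ.* j ℤ.* (ℤ.+ 2 ℤ.* j) ℤ.+ (ℤ.- 1ℤ ℤ.+ j ℤ.* j) ℤ.* (ℤ.- 1ℤ ℤ.+ j ℤ.* j)
      identity = ℤ.solve-∀

    large : ∀ i s → N ℤ.* i ≡ s ℤ.* M → i ≢ 0ℤ → ∣ i ∣ ℕ.≤ K k → ⊥
    large i s eq i≢0 ∣i∣≤K = ℕ.<⇒≱ (2^∣odd*i⇒<∣i∣ (K k) i (ℤ.+ 4 ℤ.* s) N-odd i≢0 (trans eq (rearrange s ((ℤ.+ 2) ^ K k)))) ∣i∣≤K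
      where
      rearrange : ∀ s w → s ℤ.* (ℤ.+ 2 ℤ.* (ℤ.+ 2 ℤ.* w)) ≡ w ℤ.* (ℤ.+ 4 ℤ.* s)
      rearrange = ℤ.solve-∀

    ac≢0 : a ℤ.* c ≢ 0ℤ
    ac≢0 = *-≢0 a≢0 c≢0

    X₁≢0 : X₁ ≢ 0ℤ
    X₁≢0 eq = large (a ℤ.* c) e (trans (ℤ.*-comm N (a ℤ.* c)) (sym (ℤ.i-j≡0⇒i≡j _ _ eq))) ac≢0
      (ℕ.≤-trans (ℕ.m≤m+n _ _) (ℕ.m≤n+m _ k))

    excluded : ∀ x₀ → bound x₀ ℕ.≤ K k → ↥ x₀ ℤ.* X₁ ≢ X₀ ℤ.* ↧ x₀
    excluded x₀ ≤K eq = large i (e ℤ.* n ℤ.+ c ℤ.* d ℤ.* D) (ℤ.i-j≡0⇒i≡j _ _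
        (trans (identity₁ a b c d e n D M N)
          (trans (cong (λ i → ℤ.- (i ℤ.- X₀ ℤ.* D)) eq) (cong ℤ.-_ (ℤ.+-inverseʳ (X₀ ℤ.* D))))))
      (*-≢0 ac≢0 n+bD≢0) ≤K
      where
      n D i : ℤ
      n = ↥ x₀
      D = ↧ x₀
      i = a ℤ.* c ℤ.* (n ℤ.+ b ℤ.* D)
      identity₁ : ∀ a b c d e n D M N →
        N ℤ.* (a ℤ.* c ℤ.* (n ℤ.+ b ℤ.* D)) ℤ.- (e ℤ.* n ℤ.+ c ℤ.* d ℤ.* D) ℤ.* M
        ≡ ℤ.- (n ℤ.* (e ℤ.* M ℤ.- a ℤ.* c ℤ.* N) ℤ.- (N ℤ.* (a ℤ.* b ℤ.* c) ℤ.- c ℤ.* d ℤ.* M) ℤ.* D)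
      identity₁ = ℤ.solve-∀
      identity₂ : ∀ a b c d e n D M N →
        M ℤ.* (D ℤ.* (b ℤ.* e ℤ.- c ℤ.* d))
        ≡ (e ℤ.* M ℤ.- a ℤ.* c ℤ.* N) ℤ.* (n ℤ.+ b ℤ.* D)
          ℤ.- (n ℤ.* (e ℤ.* M ℤ.- a ℤ.* c ℤ.* N) ℤ.- (N ℤ.* (a ℤ.* b ℤ.* c) ℤ.- c ℤ.* d ℤ.* M) ℤ.* D)
      identity₂ = ℤ.solve-∀
      -- Since `x + b = M δ / X₁`, the value `- b` would force `δ` to vanish.
      n+bD≢0 : n ℤ.+ b ℤ.* D ≢ 0ℤ
      n+bD≢0 n+bD≡0 = *-≢0 M≢0 (*-≢0 {D} (λ ()) δ≢0) (trans (identity₂ a b c d e n D M N)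
        (trans (cong₂ (λ i j → X₁ ℤ.* i ℤ.- j) n+bD≡0 (trans (cong (ℤ._- X₀ ℤ.* D) eq) (ℤ.+-inverseʳ (X₀ ℤ.* D))))
          (trans (ℤ.+-identityʳ _) (ℤ.*-zeroʳ X₁))))

    κ x : ℚ
    κ = proj₁ (inverse (ι≢0 X₁≢0))
    x = κ * ι X₀

    κX₁≡1 : κ * ι X₁ ≡ 1ℚ
    κX₁≡1 = proj₂ (inverse (ι≢0 X₁≢0))

    avoids : ∀ x₀ → bound x₀ ℕ.≤ K k → x ≢ x₀
    avoids x₀ ≤K = excluded x₀ ≤K ∘ cross-multiply X₀ X₁ (begin
      κ * ι X₀ * ι X₁    ≡⟨ rearrange κ (ι X₀) (ι X₁) ⟩
      κ * ι X₁ * ι X₀    ≡⟨ cong (_* ι X₀) κX₁≡1 ⟩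
      1ℚ * ι X₀          ≡⟨ ℚ.*-identityˡ (ι X₀) ⟩
      ι X₀               ∎) x₀
      where
      rearrange : ∀ κ p q → κ * p * q ≡ κ * q * p
      rearrange = solve-∀ ℚ-ring

    x≢0 : x ≢ 0ℚ
    x≢0 = avoids 0ℚ (ℕ.≤-trans (ℕ.m≤m+n _ _) (ℕ.≤-trans (ℕ.m≤n+m _ ∣ a ℤ.* c ∣) (ℕ.m≤n+m _ k)))

    x+a≢0 : x + ι a ≢ 0ℚ
    x+a≢0 = x+i≢0 a (avoids _ (ℕ.≤-trans (ℕ.m≤m+n _ _)
      (ℕ.≤-trans (ℕ.m≤n+m _ (bound 0ℚ)) (ℕ.≤-trans (ℕ.m≤n+m _ ∣ a ℤ.* c ∣) (ℕ.m≤n+m _ k)))))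

    x+c≢0 : x + ι c ≢ 0ℚ
    x+c≢0 = x+i≢0 c (avoids _ (ℕ.≤-trans (ℕ.m≤n+m _ (bound (ι (ℤ.- a))))
      (ℕ.≤-trans (ℕ.m≤n+m _ (bound 0ℚ)) (ℕ.≤-trans (ℕ.m≤n+m _ ∣ a ℤ.* c ∣) (ℕ.m≤n+m _ k)))))

    A B C D E m n i : ℚ
    A = ι a
    B = ι b
    C = ι c
    D = ι d
    E = ι e
    m = ι M
    n = ι N
    i = proj₁ (inverse x≢0)

    ix≡1 : i * x ≡ 1ℚ
    ix≡1 = proj₂ (inverse x≢0)

    κX₀≡x′ : κ * (n * (A * B * C) - C * D * m) ≡ x
    κX₀≡x′ = cong (κ *_) (sym (begin
      ι X₀
        ≡⟨ ι-sub (N ℤ.* (a ℤ.* b ℤ.* c)) (c ℤ.* d ℤ.* M) ⟩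
      ι (N ℤ.* (a ℤ.* b ℤ.* c)) - ι (c ℤ.* d ℤ.* M)
        ≡⟨ cong₂ _-_ (ι-* N (a ℤ.* b ℤ.* c)) (ι-* (c ℤ.* d) M) ⟩
      n * ι (a ℤ.* b ℤ.* c) - ι (c ℤ.* d) * m
        ≡⟨ cong₂ (λ p q → n * p - q * m) (trans (ι-* (a ℤ.* b) c) (cong (_* C) (ι-* a b))) (ι-* c d) ⟩
      n * (A * B * C) - C * D * m ∎))

    κX₁≡1′ : κ * (E * m - A * C * n) ≡ 1ℚ
    κX₁≡1′ = trans (cong (κ *_) (sym (begin
      ι X₁
        ≡⟨ ι-sub (e ℤ.* M) (a ℤ.* c ℤ.* N) ⟩
      ι (e ℤ.* M) - ι (a ℤ.* c ℤ.* N)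
        ≡⟨ cong₂ _-_ (ι-* e M) (ι-* (a ℤ.* c) N) ⟩
      E * m - ι (a ℤ.* c) * n
        ≡⟨ cong (λ p → E * m - p * n) (ι-* a c) ⟩
      E * m - A * C * n ∎))) κX₁≡1

    ιδ : ι δ ≡ B * E - C * D
    ιδ = trans (ι-sub (b ℤ.* e) (c ℤ.* d)) (cong₂ _-_ (ι-* b e) (ι-* c d))

    i≢0 : i ≢ 0ℚ
    i≢0 = inverse≢0 {i} {x} ix≡1

    κ≢0 : κ ≢ 0ℚ
    κ≢0 = inverse≢0 {κ} {ι X₁} κX₁≡1

    y v : ℚ
    y = C * D * i
    -- As `x + b = κ δ M`, this is the cofactor of `M` in `f (x)`.
    v = (x + A) * (x + C) * (i * (κ * ι δ))

    y≢0 : y ≢ 0ℚ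
    y≢0 = _*≢0_ {C * D} {i} (_*≢0_ {C} {D} (ι≢0 c≢0) (ι≢0 d≢0)) i≢0

    v≢0 : v ≢ 0ℚ
    v≢0 = _*≢0_ {(x + A) * (x + C)} {i * (κ * ι δ)} (_*≢0_ {x + A} {x + C} x+a≢0 x+c≢0)
      (_*≢0_ {i} {κ * ι δ} i≢0 (_*≢0_ {κ} {ι δ} κ≢0 (ι≢0 δ≢0)))

    f-eq : v * m * x ≡ (x + A) * (x + B) * (x + C)
    f-eq = begin
      (x + A) * (x + C) * (i * (κ * ι δ)) * m * x
        ≡⟨ cong (λ δ → (x + A) * (x + C) * (i * (κ * δ)) * m * x) ιδ ⟩
      (x + A) * (x + C) * (i * (κ * (B * E - C * D))) * m * x
        ≡⟨ collect x A B C D E m n i κ ⟩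
      F (i * x) (κ * (n * (A * B * C) - C * D * m)) (κ * (E * m - A * C * n))
        ≡⟨ cong₂ (λ o p → F o p (κ * (E * m - A * C * n))) ix≡1 κX₀≡x′ ⟩
      F 1ℚ x (κ * (E * m - A * C * n))
        ≡⟨ cong (F 1ℚ x) κX₁≡1′ ⟩
      F 1ℚ x 1ℚ
        ≡⟨ simplify x A B C ⟩
      (x + A) * (x + B) * (x + C) ∎
      where
      F : ℚ → ℚ → ℚ → ℚ
      F o p o′ = (x + A) * (x + C) * (o * (p + B * o′))
      collect : ∀ x A B C D E m n i κ →
        (x + A) * (x + C) * (i * (κ * (B * E - C * D))) * m * x ≡
        (x + A) * (x + C) * (i * x * (κ * (n * (A * B * C) - C * D * m) + B * (κ * (E * m - A * C * n))))
      collect = solve-∀ ℚ-ring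
      simplify : ∀ x A B C → (x + A) * (x + C) * (1ℚ * (x + B * 1ℚ)) ≡ (x + A) * (x + B) * (x + C)
      simplify = solve-∀ ℚ-ring

    -- With `i = 1 / x`, the factors on the right are `α i (x + a)`, `i (c d + e x)` and
    -- `d i (x + c)`, and `c d + e x = a c κ δ N`.
    g-eq : v * n * (y * y) ≡ (y + α) * (y + E) * (y + D)
    g-eq = begin
      (x + A) * (x + C) * (i * (κ * ι δ)) * n * (C * D * i * (C * D * i))
        ≡⟨ cong (λ δ → (x + A) * (x + C) * (i * (κ * δ)) * n * (C * D * i * (C * D * i))) ιδ ⟩
      (x + A) * (x + C) * (i * (κ * (B * E - C * D))) * n * (C * D * i * (C * D * i))
        ≡⟨ regroup x A B C D E n i κ ⟩
      P (C * D)
        ≡⟨ cong P aα≡cd ⟨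
      P (A * α)
        ≡⟨ collect x A B C D E α m n i κ ⟩
      Q (κ * (n * (A * B * C) - C * D * m)) (κ * (E * m - A * C * n))
        ≡⟨ cong₂ Q κX₀≡x′ κX₁≡1′ ⟩
      Q x 1ℚ
        ≡⟨ expand x A C D E α i ⟩
      G (A * α) (i * x)
        ≡⟨ cong₂ G aα≡cd ix≡1 ⟩
      G (C * D) 1ℚ
        ≡⟨ simplify C D E α i ⟩
      (C * D * i + α) * (C * D * i + E) * (C * D * i + D) ∎
      where
      P : ℚ → ℚ
      P p = (x + A) * (x + C) * (i * i * i) * D * p * C * κ * n * (B * E - C * D)
      Q G : ℚ → ℚ → ℚ
      Q p o = i * i * i * α * D * (x + A) * (x + C) * (C * D * o + E * p)
      G p o = (p * i + α * o) * (C * D * i + E * o) * (C * D * i + D * o)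
      regroup : ∀ x A B C D E n i κ →
        (x + A) * (x + C) * (i * (κ * (B * E - C * D))) * n * (C * D * i * (C * D * i)) ≡
        (x + A) * (x + C) * (i * i * i) * D * (C * D) * C * κ * n * (B * E - C * D)
      regroup = solve-∀ ℚ-ring
      collect : ∀ x A B C D E α m n i κ →
        (x + A) * (x + C) * (i * i * i) * D * (A * α) * C * κ * n * (B * E - C * D) ≡
        i * i * i * α * D * (x + A) * (x + C) * (C * D * (κ * (E * m - A * C * n)) + E * (κ * (n * (A * B * C) - C * D * m)))
      collect = solve-∀ ℚ-ring
      expand : ∀ x A C D E α i → i * i * i * α * D * (x + A) * (x + C) * (C * D * 1ℚ + E * x) ≡
        (A * α * i + α * (i * x)) * (C * D * i + E * (i * x)) * (C * D * i + D * (i * x))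
      expand = solve-∀ ℚ-ring
      simplify : ∀ C D E α i → (C * D * i + α * 1ℚ) * (C * D * i + E * 1ℚ) * (C * D * i + D * 1ℚ) ≡
        (C * D * i + α) * (C * D * i + E) * (C * D * i + D)
      simplify = solve-∀ ℚ-ring

  family : Family (ι a) (ι b) (ι c) α (ι e) (ι d)
  family = record
    { bound = bound
    ; solution = λ k → record
      { x = x k ; y = y k ; v = v k ; triple = triple k ; x≢0 = x≢0 k ; y≢0 = y≢0 k ; v≢0 = v≢0 k
      ; f-eq = f-eq k ; g-eq = g-eq k
      }
    ; avoids = λ k x₀ ≤k → avoids k x₀ (ℕ.≤-trans ≤k (ℕ.m≤m+n k _))
    }

-- The case `b e ≡ c d`: points on a curve of genus one

2∣∣i∣ : ∀ {i} → Even i → 2 ℕ.∣ ∣ i ∣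
2∣∣i∣ (j , refl) = ℕ.divides ∣ j ∣ (trans (twice j) (ℕ.*-comm 2 ∣ j ∣))

parity-of-fraction : ∀ p → Odd (↧ p) ⊎ Odd (↥ p)
parity-of-fraction p@(mkℚ _ _ coprime) with parity (↧ p) | parity (↥ p)
... | inj₂ q-odd | _ = inj₁ q-odd
... | inj₁ _ | inj₂ r-odd = inj₂ r-odd
... | inj₁ (q′ , q≡2q′) | inj₁ (r′ , r≡2r′)
  -- The coprimality proof inside a rational is irrelevant, so it is recomputed before use.
  with () ← ℕ.recompute coprime (2∣∣i∣ (r′ , r≡2r′) , 2∣∣i∣ (q′ , q≡2q′))

-- Here `a`, `b`, `c` are what remains after the common factor `g` is removed. The parameters of the
-- problem are `A`, `B`, `C`, with `d = p A B` and `e = p A C`.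
module Elliptic (g a b c : ℤ) (p : ℚ) (g≢0 : g ≢ 0ℤ) (c-odd : Odd c) (p≢0 : p ≢ 0ℚ) where

  A B C G : ℚ
  G = ι g
  A = G * ι a
  B = G * ι b
  C = G * ι c

  -- If `- g N / M = x₀`, the power of 2 in `M` divides `N` times this integer, and `N` is odd.
  bound : ℚ → ℕ
  bound x₀ = ∣ g ℤ.* ↧ x₀ ∣

  ↥p≢0 : ↥ p ≢ 0ℤ
  ↥p≢0 = p≢0 ∘ ℚ.↥p≡0⇒p≡0 p

  module _ (k : ℕ) where

    E : EllipticTriple (↧ p) (↥ p) c (a ℤ.* b) k
    E = elliptic-triple (↧ p) (↥ p) c (a ℤ.* b) (λ ()) ↥p≢0 (parity-of-fraction p) c-odd k

    open EllipticTriple E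

    m n κ w x y v : ℚ
    m = ι M
    n = ι N
    κ = proj₁ (inverse (ι≢0 M≢0))
    w = proj₁ (inverse (ι≢0 (odd≢0 N-odd)))
    -- The root `- N / M` belongs to the reduced parameters; homogeneity scales it by `G`.
    x = - (G * n) * κ
    y = p * C * x
    -- The remaining factor of `f (x)` is `(x + C) / x = (N - c M) / N = w² U`.
    v = (x + A) * (x + B) * (w * w)

    wn≡1 : w * n ≡ 1ℚ
    wn≡1 = proj₂ (inverse (ι≢0 (odd≢0 N-odd)))

    xm≡-Gn : x * m ≡ - (G * n)
    xm≡-Gn = trans (ℚ.*-assoc (- (G * n)) κ m) (trans (cong (- (G * n) *_) (proj₂ (inverse (ι≢0 M≢0)))) (ℚ.*-identityʳ _))

    xm≡ι : x * m ≡ ι (ℤ.- (g ℤ.* N))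
    xm≡ι = trans xm≡-Gn (trans (cong -_ (sym (ι-* g N))) (sym (ι-neg (g ℤ.* N))))

    wxm≡-G : w * (x * m) ≡ - G
    wxm≡-G = begin
      w * (x * m)      ≡⟨ cong (w *_) xm≡-Gn ⟩
      w * - (G * n)    ≡⟨ rearrange w G n ⟩
      - (G * (w * n))  ≡⟨ cong (λ o → - (G * o)) wn≡1 ⟩
      - (G * 1ℚ)       ≡⟨ cong -_ (ℚ.*-identityʳ G) ⟩
      - G              ∎
      where
      rearrange : ∀ w G n → w * - (G * n) ≡ - (G * (w * n))
      rearrange = solve-∀ ℚ-ring

    avoids : ∀ x₀ → bound x₀ ℕ.≤ k → x ≢ x₀
    avoids x₀ ≤k x≡x₀ = ℕ.<⇒≱ (2^∣odd*i⇒<∣i∣ k (g ℤ.* ↧ x₀) (ℤ.- (ℤ.+ 2 ℤ.* s ℤ.* ↥ x₀)) N-odd (*-≢0 {j = ↧ x₀} g≢0 (λ ())) (begin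
      N ℤ.* (g ℤ.* ↧ x₀)                                ≡⟨ identity₁ N g (↧ x₀) ⟩
      ℤ.- (ℤ.- (g ℤ.* N) ℤ.* ↧ x₀)                  ≡⟨ cong ℤ.-_ (cross-multiply (ℤ.- (g ℤ.* N)) M xm≡ι x₀ x≡x₀) ⟨
      ℤ.- (↥ x₀ ℤ.* M)                                  ≡⟨ identity₂ (↥ x₀) ((ℤ.+ 2) ^ k) s ⟩
      (ℤ.+ 2) ^ k ℤ.* ℤ.- (ℤ.+ 2 ℤ.* s ℤ.* ↥ x₀) ∎)) ≤k
      where
      identity₁ : ∀ N g d → N ℤ.* (g ℤ.* d) ≡ ℤ.- (ℤ.- (g ℤ.* N) ℤ.* d)
      identity₁ = ℤ.solve-∀
      identity₂ : ∀ r w s → ℤ.- (r ℤ.* (ℤ.+ 2 ℤ.* (w ℤ.* s))) ≡ w ℤ.* ℤ.- (ℤ.+ 2 ℤ.* s ℤ.* r)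
      identity₂ = ℤ.solve-∀

    -- Otherwise `i M = N`, with `M` even and `N` odd.
    x+gi≢0 : ∀ i → x + G * ι i ≢ 0ℚ
    x+gi≢0 i = subst (λ q → x + q ≢ 0ℚ) (ι-* g i) (x+i≢0 (g ℤ.* i) λ x≡-gi →
      even⇒¬odd (even-*ʳ i ((ℤ.+ 2) ^ k ℤ.* s , refl)) (subst Odd (sym (iM≡N x≡-gi)) N-odd))
      where
      iM≡N : x ≡ ι (ℤ.- (g ℤ.* i)) → i ℤ.* M ≡ N
      iM≡N x≡-gi = ℤ.*-cancelˡ-≡ g _ _ {{ℤ.≢-nonZero g≢0}} (ℤ.neg-injective (begin
        ℤ.- (g ℤ.* (i ℤ.* M))   ≡⟨ rearrange g i M ⟩
        ℤ.- (g ℤ.* i) ℤ.* M     ≡⟨ ι-injective (trans (ι-* (ℤ.- (g ℤ.* i)) M) (trans (cong (_* m) (sym x≡-gi)) xm≡ι)) ⟩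
        ℤ.- (g ℤ.* N)             ∎))
        where
        rearrange : ∀ g i M → ℤ.- (g ℤ.* (i ℤ.* M)) ≡ ℤ.- (g ℤ.* i) ℤ.* M
        rearrange = ℤ.solve-∀

    x≢0 : x ≢ 0ℚ
    x≢0 x≡0 = ι≢0 (*-≢0 g≢0 (odd≢0 N-odd)) (trans (ι-* g N) (ℚ.neg-injective {q = 0ℚ} (trans (sym xm≡-Gn) (trans (cong (_* m) x≡0) (ℚ.*-zeroˡ m)))))

    y≢0 : y ≢ 0ℚ
    y≢0 = _*≢0_ {p * C} {x} (_*≢0_ {p} {C} p≢0 (_*≢0_ {G} {ι c} (ι≢0 g≢0) (ι≢0 (odd≢0 c-odd)))) x≢0

    v≢0 : v ≢ 0ℚ
    v≢0 = _*≢0_ {(x + A) * (x + B)} {w * w} (_*≢0_ {x + A} {x + B} (x+gi≢0 a) (x+gi≢0 b)) (_*≢0_ {w} {w} w≢0 w≢0)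
      where
      w≢0 : w ≢ 0ℚ
      w≢0 = inverse≢0 {w} {n} wn≡1

    ιU : ι U ≡ n * (n - ι c * m)
    ιU = begin
      ι U                              ≡⟨ cong ι U-eq ⟩
      ι (N ℤ.* (N ℤ.- c ℤ.* M))  ≡⟨ ι-* N (N ℤ.- c ℤ.* M) ⟩
      n * ι (N ℤ.- c ℤ.* M)        ≡⟨ cong (n *_) (trans (ι-sub N (c ℤ.* M)) (cong (λ q → n - q) (ι-* c M))) ⟩
      n * (n - ι c * m)                ∎

    ιV : ι V ≡ p * (m * (ι a * ι b * m - ι c * n))
    ιV = *-cancelˡ {ι (↧ p)} (ι≢0 {↧ p} (λ ())) (begin
      ι (↧ p) * ι V
        ≡⟨ ι-* (↧ p) V ⟨
      ι (↧ p ℤ.* V)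
        ≡⟨ cong ι V-eq ⟩
      ι (↥ p ℤ.* (M ℤ.* (a ℤ.* b ℤ.* M ℤ.- c ℤ.* N)))
        ≡⟨ trans (ι-* (↥ p) (M ℤ.* (a ℤ.* b ℤ.* M ℤ.- c ℤ.* N))) (cong (ι (↥ p) *_) (ι-* M (a ℤ.* b ℤ.* M ℤ.- c ℤ.* N))) ⟩
      ι (↥ p) * (m * ι (a ℤ.* b ℤ.* M ℤ.- c ℤ.* N))
        ≡⟨ cong (λ q → ι (↥ p) * (m * q)) (trans (ι-sub (a ℤ.* b ℤ.* M) (c ℤ.* N))
             (cong₂ _-_ (trans (ι-* (a ℤ.* b) M) (cong (_* m) (ι-* a b))) (ι-* c N))) ⟩
      ι (↥ p) * (m * (ι a * ι b * m - ι c * n))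
        ≡⟨ cong (_* (m * (ι a * ι b * m - ι c * n))) (num/den p) ⟨
      p * ι (↧ p) * (m * (ι a * ι b * m - ι c * n))
        ≡⟨ rearrange p (ι (↧ p)) (m * (ι a * ι b * m - ι c * n)) ⟩
      ι (↧ p) * (p * (m * (ι a * ι b * m - ι c * n))) ∎)
      where
      rearrange : ∀ p q r → p * q * r ≡ q * (p * r)
      rearrange = solve-∀ ℚ-ring

    f-eq : v * ι U * x ≡ (x + A) * (x + B) * (x + C)
    f-eq = begin
      v * ι U * x                     ≡⟨ cong (λ q → v * q * x) ιU ⟩
      v * (n * (n - ι c * m)) * x     ≡⟨ collect x A B (ι c) m n w ⟩
      F (w * n) (w * (x * m))         ≡⟨ cong₂ F wn≡1 wxm≡-G ⟩
      F 1ℚ (- G)                      ≡⟨ simplify x A B (ι c) G ⟩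
      (x + A) * (x + B) * (x + C)     ∎
      where
      F : ℚ → ℚ → ℚ
      F o q = (x + A) * (x + B) * (o * (o * x - ι c * q))
      collect : ∀ x A B c m n w → (x + A) * (x + B) * (w * w) * (n * (n - c * m)) * x ≡
        (x + A) * (x + B) * (w * n * (w * n * x - c * (w * (x * m))))
      collect = solve-∀ ℚ-ring
      simplify : ∀ x A B c G → (x + A) * (x + B) * (1ℚ * (1ℚ * x - c * - G)) ≡ (x + A) * (x + B) * (x + G * c)
      simplify = solve-∀ ℚ-ring

    -- The factors on the right are `p C (x + B)`, `p C (x + A)` and `p (C x + A B)`. Dividing by
    -- `y²` leaves `(x + A) (x + B)` times `p (C x + A B) / x²`, which is `w² V`.
    g-eq : v * ι V * (y * y) ≡ (y + p * B * C) * (y + p * A * C) * (y + p * A * B)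
    g-eq = begin
      v * ι V * (y * y)
        ≡⟨ cong (λ q → v * q * (y * y)) ιV ⟩
      v * (p * (m * (ι a * ι b * m - ι c * n))) * (y * y)
        ≡⟨ collect x A B C p (ι a) (ι b) (ι c) m n w ⟩
      H (w * n) (w * (x * m))
        ≡⟨ cong₂ H wn≡1 wxm≡-G ⟩
      H 1ℚ (- G)
        ≡⟨ simplify x p (ι a) (ι b) (ι c) G ⟩
      (y + p * B * C) * (y + p * A * C) * (y + p * A * B) ∎
      where
      H : ℚ → ℚ → ℚ
      H o q = (x + A) * (x + B) * (p * p * p * (C * C)) * (q * (ι a * ι b * q - ι c * (o * x)))
      collect : ∀ x A B C p a b c m n w →
        (x + A) * (x + B) * (w * w) * (p * (m * (a * b * m - c * n))) * (p * C * x * (p * C * x)) ≡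
        (x + A) * (x + B) * (p * p * p * (C * C)) * (w * (x * m) * (a * b * (w * (x * m)) - c * (w * n * x)))
      collect = solve-∀ ℚ-ring
      simplify : ∀ x p a b c G →
        (x + G * a) * (x + G * b) * (p * p * p * (G * c * (G * c))) * (- G * (a * b * - G - c * (1ℚ * x))) ≡
        (p * (G * c) * x + p * (G * b) * (G * c)) * (p * (G * c) * x + p * (G * a) * (G * c)) * (p * (G * c) * x + p * (G * a) * (G * b))
      simplify = solve-∀ ℚ-ring

  family : Family A B C (p * B * C) (p * A * C) (p * A * B)
  family = record
    { bound = bound
    ; solution = λ k → record
      { x = x k ; y = y k ; v = v k ; triple = EllipticTriple.triple (E k)
      ; x≢0 = x≢0 k ; y≢0 = y≢0 k ; v≢0 = v≢0 k ; f-eq = f-eq k ; g-eq = g-eq k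
      }
    ; avoids = avoids
    }

-- Permuting `a`, `b`, `c` only permutes the zeros of `f` and of `g`, so an odd cofactor can be
-- moved to the third place.
elliptic-family : ∀ {a b c} (p : ℚ) → p ≢ 0ℚ → OddMultiples a b c →
  Family (ι a) (ι b) (ι c) (p * ι b * ι c) (p * ι a * ι c) (p * ι a * ι b)
elliptic-family p p≢0 (g , a , b , c , g≢0 , refl , refl , refl , one-odd)
  rewrite ι-* g a | ι-* g b | ι-* g c with one-odd
... | inj₂ (inj₂ c-odd) = Elliptic.family g a b c p g≢0 c-odd p≢0
... | inj₂ (inj₁ b-odd) = map-family (permute-f (ι g * ι a) (ι g * ι b) (ι g * ι c)) (permute-g p (ι g * ι a) (ι g * ι b) (ι g * ι c))
  (Elliptic.family g a c b p g≢0 b-odd p≢0)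
  where
  permute-f : ∀ a b c x → (x + a) * (x + c) * (x + b) ≡ (x + a) * (x + b) * (x + c)
  permute-f = solve-∀ ℚ-ring
  permute-g : ∀ p a b c y → (y + p * c * b) * (y + p * a * b) * (y + p * a * c) ≡ (y + p * b * c) * (y + p * a * c) * (y + p * a * b)
  permute-g = solve-∀ ℚ-ring
... | inj₁ a-odd = map-family (permute-f (ι g * ι a) (ι g * ι b) (ι g * ι c)) (permute-g p (ι g * ι a) (ι g * ι b) (ι g * ι c))
  (Elliptic.family g c b a p g≢0 a-odd p≢0)
  where
  permute-f : ∀ a b c x → (x + c) * (x + b) * (x + a) ≡ (x + a) * (x + b) * (x + c)
  permute-f = solve-∀ ℚ-ring
  permute-g : ∀ p a b c y → (y + p * b * a) * (y + p * c * a) * (y + p * c * b) ≡ (y + p * b * c) * (y + p * a * c) * (y + p * a * b)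
  permute-g = solve-∀ ℚ-ring

-- Matching both cases with the given parameters

module _ (a b c d e : ℤ) (a≢0 : a ≢ 0ℤ) (b≢0 : b ≢ 0ℤ) (c≢0 : c ≢ 0ℤ) (d≢0 : d ≢ 0ℤ) where

  α : ℚ
  α = cd/a a c d a≢0

  aα≡cd : ι a * α ≡ ι c * ι d
  aα≡cd = trans (ℚ.*-comm (ι a) α) (÷-* (ι c * ι d) (ι≢0 a≢0))

  conic-case : b ℤ.* e ≢ c ℤ.* d → Family (ι a) (ι b) (ι c) (ι d) (ι e) α
  conic-case be≢cd = map-family (λ _ → refl) (reverse α (ι e) (ι d)) (Conic.family a b c d e α a≢0 c≢0 d≢0 aα≡cd be≢cd)

  elliptic-case : b ℤ.* e ≡ c ℤ.* d → Family (ι a) (ι b) (ι c) (ι d) (ι e) α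
  elliptic-case be≡cd = map-family (λ _ → refl) same-g (elliptic-family p p≢0 (odd-multiples a b c a≢0))
    where
    ab≢0 : ι a * ι b ≢ 0ℚ
    ab≢0 = ι≢0 a≢0 *≢0 ι≢0 b≢0
    p : ℚ
    -- Chosen so that `p a b = d`; then `p b c = c d / a`, and `b e = c d` turns `p a c` into `e`.
    p = _÷_ (ι d) (ι a * ι b) {{≢-nonZero ab≢0}}
    pab≡d : p * (ι a * ι b) ≡ ι d
    pab≡d = ÷-* (ι d) ab≢0
    p≢0 : p ≢ 0ℚ
    p≢0 p≡0 = ι≢0 d≢0 (trans (sym pab≡d) (trans (cong (_* (ι a * ι b)) p≡0) (ℚ.*-zeroˡ (ι a * ι b))))
    pabc≡cd : p * (ι a * ι b) * ι c ≡ ι c * ι d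
    pabc≡cd = trans (cong (_* ι c) pab≡d) (ℚ.*-comm (ι d) (ι c))
    pbc≡α : p * ι b * ι c ≡ α
    pbc≡α = *-cancelˡ (ι≢0 a≢0) (trans (rearrange p (ι a) (ι b) (ι c)) (trans pabc≡cd (sym aα≡cd)))
      where
      rearrange : ∀ p a b c → a * (p * b * c) ≡ p * (a * b) * c
      rearrange = solve-∀ ℚ-ring
    pac≡e : p * ι a * ι c ≡ ι e
    pac≡e = *-cancelˡ (ι≢0 b≢0) (trans (rearrange p (ι a) (ι b) (ι c))
      (trans pabc≡cd (trans (sym (ι-* c d)) (trans (cong ι (sym be≡cd)) (ι-* b e)))))
      where
      rearrange : ∀ p a b c → b * (p * a * c) ≡ p * (a * b) * c
      rearrange = solve-∀ ℚ-ring
    same-g : ∀ y → (y + p * ι b * ι c) * (y + p * ι a * ι c) * (y + p * ι a * ι b) ≡ (y + ι d) * (y + ι e) * (y + α)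
    same-g y = trans (cong₂ _*_ (cong₂ (λ α e → (y + α) * (y + e)) pbc≡α pac≡e) (cong (λ q → y + q) (trans (ℚ.*-assoc p (ι a) (ι b)) pab≡d)))
      (reverse α (ι e) (ι d) y)

theorem1p4 : (a b c d e : ℤ) → (a≢0 : a ≢ 0ℤ) → b ≢ 0ℤ → c ≢ 0ℤ → d ≢ 0ℤ → e ≢ 0ℤ →
    Infinite (NontrivialSolution plus a b c d e a≢0)
    ⊎ Infinite (NontrivialSolution minus a b c d e a≢0)
theorem1p4 a b c d e a≢0 b≢0 c≢0 d≢0 e≢0 with b ℤ.* e ℤ.≟ c ℤ.* d
... | no be≢cd = inj₁ (infinite {a≢0 = a≢0} (conic-case a b c d e a≢0 b≢0 c≢0 d≢0 be≢cd))
... | yes be≡cd = inj₁ (infinite {a≢0 = a≢0} (elliptic-case a b c d e a≢0 b≢0 c≢0 d≢0 be≡cd))
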